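{- For all $n\geq 1$, \[a_{2(2)}(n)=b_2(n)+b_2(n+1)-b_2(n+2).\]
   Context: For $\ell\ge 2$, an $\ell$-regular partition is a partition with no part divisible by $\ell$, and $b_\ell(n)$ is the number of $\ell$-regular partitions of $n$. $a_{m(\ell)}(n)$ is the number of $\ell$-regular partitions of $n$ in which the smallest part occurs at least $m$ times; here $\ell=2$, $m=2$. -}

module Defs where

open import Data.Nat using (ℕ; zero; suc; _+_; _≤_; z≤n; s≤s; _≟_; _≤?_)
open import Data.Nat.Properties using (suc-injective)
open import Data.Nat.Divisibility using (_∣_; _∣?_)
open import Data.List using (List; []; _∷_; _++_; map; filter; length)
open import Data.Nat.ListAction using (sum)
open import Data.List.Properties using (∷-injectiveˡ; ∷-injectiveʳ)
open import Data.List.Membership.Propositional using (_∈_)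
open import Data.List.Membership.Propositional.Properties
  using (∈-map⁺; ∈-map⁻; ∈-++⁺ˡ; ∈-++⁺ʳ; ∈-++⁻; ∈-filter⁺; ∈-filter⁻)
open import Data.List.Relation.Unary.All using (All; []; _∷_; all?)
open import Data.List.Relation.Unary.Any using (Any; here; there; any?)
open import Data.List.Relation.Unary.AllPairs using ([]; _∷_)
open import Data.List.Relation.Unary.Linked using (Linked; linked?)
open import Data.List.Relation.Unary.Unique.Propositional using (Unique)
import Data.List.Relation.Unary.Unique.Propositional.Properties as Uniqueₚ
open import Data.Product using (_×_; _,_; proj₂)
open import Data.Sum using (inj₁; inj₂)
open import Function.Bundles using (_⇔_; mk⇔)
open import Relation.Binary.PropositionalEquality using (_≡_; refl; cong₂)
open import Relation.Nullary using (¬_; Dec; ¬?)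
open import Relation.Nullary.Decidable using (_×-dec_)

-- A partition, i.e. a multiset of positive integers, is represented by the
-- list of its parts in weakly increasing order.

IsPartition : ℕ → List ℕ → Set
IsPartition n xs = Linked _≤_ xs × All (1 ≤_) xs × sum xs ≡ n

isPartition? : ∀ n xs → Dec (IsPartition n xs)
isPartition? n xs = linked? _≤?_ xs ×-dec all? (1 ≤?_) xs ×-dec (sum xs ≟ n)

Regular : ℕ → List ℕ → Set
Regular ℓ xs = All (λ x → ¬ (ℓ ∣ x)) xs

regular? : ∀ ℓ xs → Dec (Regular ℓ xs)
regular? ℓ = all? (λ x → ¬? (ℓ ∣? x))

occurrences : ℕ → List ℕ → ℕ
occurrences x xs = length (filter (x ≟_) xs)

-- The empty partition has no smallest part, so it never satisfies this.

SmallestPartOccursAtLeast : ℕ → List ℕ → Set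
SmallestPartOccursAtLeast m xs = Any (λ s → All (s ≤_) xs × m ≤ occurrences s xs) xs

smallestPartOccursAtLeast? : ∀ m xs → Dec (SmallestPartOccursAtLeast m xs)
smallestPartOccursAtLeast? m xs =
  any? (λ s → all? (s ≤?_) xs ×-dec (m ≤? occurrences s xs)) xs

sucHead : List ℕ → List ℕ
sucHead []       = []
sucHead (x ∷ xs) = suc x ∷ xs

-- Ordered sequences of positive integers with sum n. A composition of n + 1,
-- n ≥ 1, either starts with 1 or arises from a composition of n by raising
-- its first entry.

compositions : ℕ → List (List ℕ)
compositions zero            = [] ∷ []
compositions (suc zero)      = (1 ∷ []) ∷ []
compositions (suc n@(suc _)) = map (1 ∷_) (compositions n) ++ map sucHead (compositions n)

partitions : ℕ → List (List ℕ)
partitions n = filter (isPartition? n) (compositions n)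

b : (ℓ n : ℕ) → ℕ
b ℓ n = length (filter (regular? ℓ) (partitions n))

-- a m ℓ n is the number written a_{m(ℓ)}(n).

a : (m ℓ n : ℕ) → ℕ
a m ℓ n = length (filter (smallestPartOccursAtLeast? m) (filter (regular? ℓ) (partitions n)))

-- The list partitions n contains every partition of n exactly once, so the
-- lengths above are the intended cardinalities.

compositions-complete : ∀ n xs → All (1 ≤_) xs → sum xs ≡ n → xs ∈ compositions n
compositions-complete zero [] _ _ = here refl
compositions-complete n (zero ∷ _) (() ∷ _) _
compositions-complete (suc zero) (suc zero ∷ []) _ _ = here refl
compositions-complete (suc zero) (suc zero ∷ zero ∷ _) (_ ∷ () ∷ _) _
compositions-complete (suc n@(suc _)) (suc zero ∷ xs) (_ ∷ ps) eq =
  ∈-++⁺ˡ (∈-map⁺ (1 ∷_) (compositions-complete n xs ps (suc-injective eq)))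
compositions-complete (suc n@(suc _)) (suc (suc x) ∷ xs) (_ ∷ ps) eq =
  ∈-++⁺ʳ (map (1 ∷_) (compositions n))
    (∈-map⁺ sucHead (compositions-complete n (suc x ∷ xs) (s≤s z≤n ∷ ps) (suc-injective eq)))

compositions-positive : ∀ n {xs} → xs ∈ compositions n → All (1 ≤_) xs
compositions-positive zero (here refl) = []
compositions-positive (suc zero) (here refl) = s≤s z≤n ∷ []
compositions-positive (suc n@(suc _)) xs∈ with ∈-++⁻ (map (1 ∷_) (compositions n)) xs∈
... | inj₁ p with _ , ys∈ , refl ← ∈-map⁻ (1 ∷_) p = s≤s z≤n ∷ compositions-positive n ys∈
... | inj₂ p with ∈-map⁻ sucHead p
...   | []    , _   , refl = []
...   | _ ∷ _ , ys∈ , refl with _ ∷ ps ← compositions-positive n ys∈ = s≤s z≤n ∷ ps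

sucHead-injective : ∀ {xs ys} → sucHead xs ≡ sucHead ys → xs ≡ ys
sucHead-injective {[]}    {[]}    _  = refl
sucHead-injective {_ ∷ _} {_ ∷ _} eq =
  cong₂ _∷_ (suc-injective (∷-injectiveˡ eq)) (∷-injectiveʳ eq)

compositions-unique : ∀ n → Unique (compositions n)
compositions-unique zero = [] ∷ []
compositions-unique (suc zero) = [] ∷ []
compositions-unique (suc n@(suc _)) = Uniqueₚ.++⁺
  (Uniqueₚ.map⁺ ∷-injectiveʳ (compositions-unique n))
  (Uniqueₚ.map⁺ sucHead-injective (compositions-unique n))
  disjoint
  where
  disjoint : ∀ {xs} → ¬ (xs ∈ map (1 ∷_) (compositions n) × xs ∈ map sucHead (compositions n))
  disjoint (p , q) with _ , _ , refl ← ∈-map⁻ (1 ∷_) p with ∈-map⁻ sucHead q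
  ... | zero ∷ _ , ys∈ , refl with () ∷ _ ← compositions-positive n ys∈

∈-partitions : ∀ n xs → xs ∈ partitions n ⇔ IsPartition n xs
∈-partitions n xs = mk⇔
  (λ xs∈ → proj₂ (∈-filter⁻ (isPartition? n) {xs = compositions n} xs∈))
  (λ p@(_ , pos , eq) → ∈-filter⁺ (isPartition? n) (compositions-complete n xs pos eq) p)

partitions-unique : ∀ n → Unique (partitions n)
partitions-unique n = Uniqueₚ.filter⁺ (isPartition? n) (compositions-unique n)

{-# OPTIONS --safe #-}

-- Among the partitions of n + 2 into odd parts, those containing a 1 correspond
-- to the odd partitions of n + 1. In the others the smallest part s is at least
-- 3, and replacing one copy of s by s − 2 gives precisely the odd partitions of
-- n whose smallest part occurs only once. Hence
-- b₂(n + 2) = b₂(n + 1) + (b₂(n) − a(n)).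

module Submission where

open import Defs
open import Data.Nat using (ℕ; _≥_; _+_; zero; suc; _≤_; _<_; z≤n; s≤s; _≟_)
open import Data.Nat.Properties
  using (≤-refl; ≤-trans; <⇒≢; <⇒≱; n≤1+n; m≤n+m; m≤n⇒m<n∨m≡n; +-comm; +-assoc; +-suc; suc-injective)
open import Data.Nat.Divisibility using (_∣_; _∣0; ∣-refl; ∣⇒≤; ∣m+n∣m⇒∣n; ∣m∣n⇒∣m+n)
open import Data.Integer using (+_) renaming (_+_ to _+ᶻ_; _-_ to _-ᶻ_)
import Data.Integer.Properties as ℤₚ
open import Algebra.Properties.AbelianGroup ℤₚ.+-0-abelianGroup using (//-rightDividesʳ)
open import Data.List using (List; []; _∷_; _++_; map; filter; length)
open import Data.List.Properties
  using (length-++; length-map; filter-accept; filter-none; ∷-injectiveʳ)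
open import Data.List.Membership.Propositional using (_∈_; find)
open import Data.List.Membership.Propositional.Properties
  using (∈-map⁺; ∈-map⁻; ∈-++⁺ˡ; ∈-++⁺ʳ; ∈-++⁻; ∈-filter⁺; ∈-filter⁻)
open import Data.List.Membership.Propositional.Properties.WithK using (unique∧set⇒bag)
open import Data.List.Relation.Binary.BagAndSetEquality using (∼bag⇒↭)
open import Data.List.Relation.Binary.Permutation.Propositional using (_↭_)
open import Data.List.Relation.Binary.Permutation.Propositional.Properties using (↭-length)
open import Data.List.Relation.Unary.All as All using (All; []; _∷_)
open import Data.List.Relation.Unary.Any using (here; there)
open import Data.List.Relation.Unary.Linked as Linked using (Linked; [-]; _∷_)
open import Data.List.Relation.Unary.Linked.Properties using (Linked⇒All)
open import Data.List.Relation.Unary.Unique.Propositional using (Unique)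
import Data.List.Relation.Unary.Unique.Propositional.Properties as Uniqueₚ
open import Data.Product using (_×_; _,_)
open import Data.Sum using (_⊎_; inj₁; inj₂; [_,_]′)
open import Function using (_∘_)
open import Function.Bundles using (mk⇔; module Equivalence)
open import Relation.Binary.PropositionalEquality
  using (_≡_; refl; sym; trans; cong; cong₂; subst; module ≡-Reasoning)
open import Relation.Nullary using (¬_; ¬?; does; contradiction)
open import Relation.Unary using (Decidable)
open import Data.Bool using (true; false)

private variable
  A : Set
  n x : ℕ
  xs ys : List ℕ

length-filter-¬? : {P : A → Set} (P? : Decidable P) (zs : List A) →
  length (filter P? zs) + length (filter (¬? ∘ P?) zs) ≡ length zs
length-filter-¬? P? [] = refl
length-filter-¬? P? (z ∷ zs) with ih ← length-filter-¬? P? zs | does (P? z)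
... | true  = cong suc ih
... | false = trans (+-suc _ _) (cong suc ih)

even-or-suc-even : ∀ k → 2 ∣ k ⊎ 2 ∣ suc k
even-or-suc-even zero          = inj₁ (2 ∣0)
even-or-suc-even (suc zero)    = inj₂ ∣-refl
even-or-suc-even (suc (suc k)) =
  [ inj₁ ∘ ∣m∣n⇒∣m+n ∣-refl , inj₂ ∘ ∣m∣n⇒∣m+n ∣-refl ]′ (even-or-suc-even k)

-- The value `1 + x` is excluded because consecutive integers cannot both be odd. This gap leaves
-- room to raise the smallest part by 2 without breaking the order.
odd-gap : ∀ {y} → ¬ 2 ∣ x → ¬ 2 ∣ y → x < y → 2 + x ≤ y
odd-gap {x} 2∤x 2∤y x<y with m≤n⇒m<n∨m≡n x<y
... | inj₁ lt   = lt
... | inj₂ refl = contradiction (even-or-suc-even x) [ 2∤x , 2∤y ]′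

-- A witness in the tail would have to be at most `x`, yet tail entries exceed `x`. The head as
-- witness is counted only once, since no later entry equals it.
smallest-once : All (x <_) xs → ¬ SmallestPartOccursAtLeast 2 (x ∷ xs)
smallest-once {x} {xs} x< p with find p
... | s , there s∈ , (s≤x ∷ _) , _ = <⇒≱ (All.lookup x< s∈) s≤x
... | _ , here refl , _ , 2≤ = contradiction (subst (2 ≤_) occurs-once 2≤) λ { (s≤s ()) }
  where
  occurs-once : occurrences x (x ∷ xs) ≡ 1
  occurs-once = cong length (trans (filter-accept (x ≟_) refl)
                                   (cong (x ∷_) (filter-none (x ≟_) (All.map <⇒≢ x<))))

smallest-twice : Linked _≤_ (x ∷ xs) → SmallestPartOccursAtLeast 2 (x ∷ x ∷ xs)
smallest-twice {x} {xs} sorted = here (≤-refl ∷ Linked⇒All ≤-trans ≤-refl sorted , 2≤occurs)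
  where
  2≤occurs : 2 ≤ occurrences x (x ∷ x ∷ xs)
  2≤occurs = subst (2 ≤_)
    (sym (cong length (trans (filter-accept (x ≟_) refl)
                             (cong (x ∷_) (filter-accept (x ≟_) refl)))))
    (s≤s (s≤s z≤n))

RegularPartition : ℕ → ℕ → List ℕ → Set
RegularPartition ℓ n xs = IsPartition n xs × Regular ℓ xs

regularPartitions : ℕ → ℕ → List (List ℕ)
regularPartitions ℓ n = filter (regular? ℓ) (partitions n)

regularPartitions-unique : ∀ ℓ n → Unique (regularPartitions ℓ n)
regularPartitions-unique ℓ n = Uniqueₚ.filter⁺ (regular? ℓ) (partitions-unique n)

∈-regularPartitions⁺ : ∀ ℓ n → RegularPartition ℓ n xs → xs ∈ regularPartitions ℓ n
∈-regularPartitions⁺ {xs} ℓ n (p , r) =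
  ∈-filter⁺ (regular? ℓ) (Equivalence.from (∈-partitions n xs) p) r

∈-regularPartitions⁻ : ∀ ℓ n → xs ∈ regularPartitions ℓ n → RegularPartition ℓ n xs
∈-regularPartitions⁻ {xs} ℓ n xs∈ with p , r ← ∈-filter⁻ (regular? ℓ) {xs = partitions n} xs∈ =
  Equivalence.to (∈-partitions n xs) p , r

-- Built from `sucHead` so that injectivity follows from `sucHead-injective`. The empty list stays
-- fixed, so its sum does not grow by 2.
raise : List ℕ → List ℕ
raise = sucHead ∘ sucHead

cons-1 : RegularPartition 2 n xs → RegularPartition 2 (suc n) (1 ∷ xs)
cons-1 ((sorted , pos , eq) , odd) =
  (linked sorted pos , ≤-refl ∷ pos , cong suc eq) , 2∤1 ∷ odd
  where
  2∤1 : ¬ 2 ∣ 1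
  2∤1 2∣1 with s≤s () ← ∣⇒≤ 2∣1

  linked : Linked _≤_ ys → All (1 ≤_) ys → Linked _≤_ (1 ∷ ys)
  linked {[]}    _ _         = [-]
  linked {_ ∷ _} s (1≤y ∷ _) = 1≤y ∷ s

uncons-1 : RegularPartition 2 (suc n) (1 ∷ xs) → RegularPartition 2 n xs
uncons-1 ((sorted , _ ∷ pos , eq) , _ ∷ odd) =
  (Linked.tail sorted , pos , suc-injective eq) , odd

-- Equal first two parts would make the smallest part occur twice. So they are distinct odd numbers,
-- at least 2 apart, and the raised head still does not exceed the second part.
raise-partition : n ≥ 1 → RegularPartition 2 n xs → ¬ SmallestPartOccursAtLeast 2 xs →
  RegularPartition 2 (2 + n) (raise xs)
-- An empty list has sum 0, which `n ≥ 1` rules out.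
raise-partition {xs = []} () ((_ , _ , refl) , _) _
raise-partition {xs = x ∷ xs} _ ((sorted , _ ∷ pos , eq) , 2∤x ∷ odd) once =
  (linked sorted odd once , s≤s z≤n ∷ pos , cong (suc ∘ suc) eq) ,
  (λ 2∣ → 2∤x (∣m+n∣m⇒∣n 2∣ ∣-refl)) ∷ odd
  where
  linked : Linked _≤_ (x ∷ ys) → Regular 2 ys →
    ¬ SmallestPartOccursAtLeast 2 (x ∷ ys) → Linked _≤_ (2 + x ∷ ys)
  linked [-] _ _ = [-]
  linked (x≤y ∷ s) (2∤y ∷ _) once with m≤n⇒m<n∨m≡n x≤y
  ... | inj₁ x<y  = odd-gap 2∤x 2∤y x<y ∷ s
  ... | inj₂ refl = contradiction (smallest-twice s) once

-- Inverse direction to `raise-partition`. All remaining parts are at least `3 + x`, so the lowered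
-- head `suc x` is strictly the smallest part.
lower-partition : RegularPartition 2 (2 + n) (3 + x ∷ xs) →
  RegularPartition 2 n (suc x ∷ xs) × ¬ SmallestPartOccursAtLeast 2 (suc x ∷ xs)
lower-partition {x = x} ((sorted , _ ∷ pos , eq) , 2∤3+x ∷ odd) =
  ( (linked sorted , s≤s z≤n ∷ pos , suc-injective (suc-injective eq))
  , (2∤3+x ∘ ∣m∣n⇒∣m+n ∣-refl) ∷ odd )
  , smallest-once (above sorted)
  where
  linked : Linked _≤_ (3 + x ∷ ys) → Linked _≤_ (suc x ∷ ys)
  linked [-]      = [-]
  linked (le ∷ s) = ≤-trans (m≤n+m _ 2) le ∷ s

  above : Linked _≤_ (3 + x ∷ ys) → All (suc x <_) ys
  above [-]      = []
  above (le ∷ s) = Linked⇒All ≤-trans (≤-trans (n≤1+n _) le) s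

-- Defined as the complement of the condition counted by `a`, so the two counts add up to `b 2 n`.
-- For `n = 0` it retains the empty partition.
smallestPartOnce : ℕ → List (List ℕ)
smallestPartOnce n = filter (¬? ∘ smallestPartOccursAtLeast? 2) (regularPartitions 2 n)

-- Both sides are duplicate-free, so having the same members already makes them permutations of each
-- other, hence of equal length.
regularPartitions-2+ : n ≥ 1 →
  regularPartitions 2 (2 + n) ↭
  map (1 ∷_) (regularPartitions 2 (1 + n)) ++ map raise (smallestPartOnce n)
regularPartitions-2+ {n} n≥1 =
  ∼bag⇒↭ (unique∧set⇒bag (regularPartitions-unique 2 (2 + n)) unique (mk⇔ to from))
  where
  ones raised : List (List ℕ)
  ones   = map (1 ∷_) (regularPartitions 2 (1 + n))
  raised = map raise (smallestPartOnce n)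

  ∈-smallestPartOnce⁻ : xs ∈ smallestPartOnce n →
    RegularPartition 2 n xs × ¬ SmallestPartOccursAtLeast 2 xs
  ∈-smallestPartOnce⁻ xs∈
    with p , q ← ∈-filter⁻ (¬? ∘ smallestPartOccursAtLeast? 2) {xs = regularPartitions 2 n} xs∈ =
    ∈-regularPartitions⁻ 2 n p , q

  -- A raised list is empty or has a head of at least 2, so it never starts with 1.
  disjoint : ¬ (xs ∈ ones × xs ∈ raised)
  disjoint (p , q) with _ , _ , refl ← ∈-map⁻ (1 ∷_) p with ∈-map⁻ raise q
  ... | []    , _ , ()
  ... | _ ∷ _ , _ , ()

  unique : Unique (ones ++ raised)
  unique = Uniqueₚ.++⁺
    (Uniqueₚ.map⁺ ∷-injectiveʳ (regularPartitions-unique 2 (1 + n)))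
    (Uniqueₚ.map⁺ (sucHead-injective ∘ sucHead-injective)
      (Uniqueₚ.filter⁺ (¬? ∘ smallestPartOccursAtLeast? 2) (regularPartitions-unique 2 n)))
    disjoint

  -- The head decides the case: 0 is not positive, 2 is even, 1 is removed, and anything from 3 on
  -- is lowered by 2.
  split : RegularPartition 2 (2 + n) xs → xs ∈ ones ++ raised
  split {[]} ((_ , _ , ()) , _)
  split {0 ∷ _} ((_ , () ∷ _ , _) , _)
  split {1 ∷ _} p = ∈-++⁺ˡ (∈-map⁺ (1 ∷_) (∈-regularPartitions⁺ 2 (1 + n) (uncons-1 p)))
  split {2 ∷ _} (_ , 2∤2 ∷ _) = contradiction ∣-refl 2∤2
  split {suc (suc (suc _)) ∷ _} p with q , once ← lower-partition p =
    ∈-++⁺ʳ ones (∈-map⁺ raise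
      (∈-filter⁺ (¬? ∘ smallestPartOccursAtLeast? 2) (∈-regularPartitions⁺ 2 n q) once))

  to : xs ∈ regularPartitions 2 (2 + n) → xs ∈ ones ++ raised
  to = split ∘ ∈-regularPartitions⁻ 2 (2 + n)

  from : xs ∈ ones ++ raised → xs ∈ regularPartitions 2 (2 + n)
  from xs∈ with ∈-++⁻ ones xs∈
  ... | inj₁ p with _ , ys∈ , refl ← ∈-map⁻ (1 ∷_) p =
    ∈-regularPartitions⁺ 2 (2 + n) (cons-1 (∈-regularPartitions⁻ 2 (1 + n) ys∈))
  ... | inj₂ p with _ , ys∈ , refl ← ∈-map⁻ raise p with q , once ← ∈-smallestPartOnce⁻ ys∈ =
    ∈-regularPartitions⁺ 2 (2 + n) (raise-partition n≥1 q once)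

-- The subtracted term is moved to the left, which keeps the counting within ℕ.
a+b≡b+b : n ≥ 1 → a 2 2 n + b 2 (2 + n) ≡ b 2 n + b 2 (1 + n)
a+b≡b+b {n} n≥1 = begin
  a 2 2 n + b 2 (2 + n)           ≡⟨ cong (λ m → a 2 2 n + m) b-2+ ⟩
  a 2 2 n + (b 2 (1 + n) + once)  ≡⟨ cong (λ m → a 2 2 n + m) (+-comm (b 2 (1 + n)) once) ⟩
  a 2 2 n + (once + b 2 (1 + n))  ≡⟨ +-assoc (a 2 2 n) once _ ⟨
  a 2 2 n + once + b 2 (1 + n)    ≡⟨ cong (_+ b 2 (1 + n))
                                       (length-filter-¬? (smallestPartOccursAtLeast? 2) (regularPartitions 2 n)) ⟩
  b 2 n + b 2 (1 + n)             ∎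
  where
  open ≡-Reasoning

  once : ℕ
  once = length (smallestPartOnce n)

  b-2+ : b 2 (2 + n) ≡ b 2 (1 + n) + once
  b-2+ = begin
    b 2 (2 + n)
      ≡⟨ ↭-length (regularPartitions-2+ n≥1) ⟩
    length (map (1 ∷_) (regularPartitions 2 (1 + n)) ++ map raise (smallestPartOnce n))
      ≡⟨ length-++ (map (1 ∷_) (regularPartitions 2 (1 + n))) ⟩
    length (map (1 ∷_) (regularPartitions 2 (1 + n))) + length (map raise (smallestPartOnce n))
      ≡⟨ cong₂ _+_ (length-map (1 ∷_) (regularPartitions 2 (1 + n))) (length-map raise (smallestPartOnce n)) ⟩
    b 2 (1 + n) + once ∎

theorem5p4 : (n : ℕ) → n ≥ 1 → + a 2 2 n ≡ (+ b 2 n +ᶻ + b 2 (n + 1)) -ᶻ + b 2 (n + 2)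
theorem5p4 n n≥1 rewrite +-comm n 1 | +-comm n 2 = begin
  + a 2 2 n
    ≡⟨ //-rightDividesʳ (+ b 2 (2 + n)) (+ a 2 2 n) ⟨
  -- Integer addition of two naturals computes to the image of their sum, so the identity in ℕ
  -- applies directly under `+_`.
  (+ a 2 2 n +ᶻ + b 2 (2 + n)) -ᶻ + b 2 (2 + n)
    ≡⟨ cong (λ m → + m -ᶻ + b 2 (2 + n)) (a+b≡b+b n≥1) ⟩
  (+ b 2 n +ᶻ + b 2 (1 + n)) -ᶻ + b 2 (2 + n) ∎
  where open ≡-Reasoning
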